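{- For every $n\ge1$, the number of conservative commutative residuated lattices with $n$ elements, up to isomorphism, is $$\mathbf C(n)=\frac1n\binom{2(n-1)}{n-1},$$ that is, the $(n-1)$th Catalan number.
   Context: A commutative residuated lattice is an algebra $\mathbf A=\langle A,\wedge,\vee,\cdot,\to,\mathrm e\rangle$ such that $\langle A,\wedge,\vee\rangle$ is a lattice, $\langle A,\cdot,\mathrm e\rangle$ is a commutative monoid, and $ab\le c\iff b\le a\to c$ for all $a,b,c\in A$. It is conservative if $ab\in\{a,b\}$ for all $a,b\in A$. The $k$th Catalan number ($k\ge0$) is $C_k=\frac1{k+1}\binom{2k}{k}$, so $C_0=1$. -}

module Defs where

open import Level using (Level; suc; _⊔_)
open import Algebra.Core using (Op₂)
open import Algebra.Structures using (IsCommutativeMonoid)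
open import Algebra.Lattice.Bundles using (Lattice)
open import Algebra.Lattice.Structures using (IsLattice)
open import Algebra.Lattice.Morphism.Structures using (IsLatticeIsomorphism)
import Algebra.Lattice.Morphism.Construct.Composition as Composition
import Algebra.Lattice.Morphism.Construct.Identity as Identity
import Algebra.Lattice.Properties.Lattice as LatticeProperties
open import Algebra.Morphism.Definitions using (Homomorphic₂; Homomorphic₀)
open import Data.Fin.Base using (Fin)
open import Data.Nat.Base using (ℕ; _*_; _/_)
import Data.Nat.Base as ℕ
open import Data.Nat.Combinatorics using (_C_)
open import Data.Product.Base using (Σ; _,_; proj₁; proj₂)
open import Data.Sum.Base using (_⊎_)
open import Function.Base using (_∘_)
open import Function.Bundles using (_⇔_; Bijection)
open import Relation.Binary.Bundles using (Setoid; Poset)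
open import Relation.Binary.Core using (Rel)
import Relation.Binary.PropositionalEquality as ≡
import Relation.Binary.Reasoning.Setoid as ≈-Reasoning

private
  variable
    c ℓ : Level

------------------------------------------------------------------------
-- Commutative residuated lattices

record CommutativeResiduatedLattice (c ℓ : Level) : Set (suc (c ⊔ ℓ)) where
  infix  4 _≈_
  infixr 8 _·_
  infixr 7 _∧_
  infixr 6 _∨_
  infixr 5 _⇒_
  field
    Carrier             : Set c
    _≈_                 : Rel Carrier ℓ
    _∧_ _∨_ _·_ _⇒_     : Op₂ Carrier
    e                   : Carrier
    isLattice           : IsLattice _≈_ _∨_ _∧_
    isCommutativeMonoid : IsCommutativeMonoid _≈_ _·_ e
    ⇒-cong              : ∀ {x y u v} → x ≈ y → u ≈ v → (x ⇒ u) ≈ (y ⇒ v)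

  lattice : Lattice c ℓ
  lattice = record { isLattice = isLattice }

  -- The order induced by the lattice:  x ≤ y  unfolds to  x ≈ x ∧ y.
  open LatticeProperties lattice public using (poset)
  open Poset poset public using (_≤_)

  field
    residuated : ∀ x y z → (x · y) ≤ z ⇔ y ≤ (x ⇒ z)

  open Lattice lattice public using (setoid; rawLattice)
  open IsCommutativeMonoid isCommutativeMonoid public
    using () renaming (∙-cong to ·-cong)

Conservative : CommutativeResiduatedLattice c ℓ → Set (c ⊔ ℓ)
Conservative L = ∀ x y → (x · y ≈ x) ⊎ (x · y ≈ y)
  where open CommutativeResiduatedLattice L

------------------------------------------------------------------------
-- Isomorphism

record IsIsomorphism (L M : CommutativeResiduatedLattice c ℓ)
                     (f : CommutativeResiduatedLattice.Carrier L →
                          CommutativeResiduatedLattice.Carrier M)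
                     : Set (c ⊔ ℓ) where
  private
    module L = CommutativeResiduatedLattice L
    module M = CommutativeResiduatedLattice M
  field
    isLatticeIsomorphism : IsLatticeIsomorphism L.rawLattice M.rawLattice f
    ·-homo : Homomorphic₂ L.Carrier M.Carrier M._≈_ f L._·_ M._·_
    ⇒-homo : Homomorphic₂ L.Carrier M.Carrier M._≈_ f L._⇒_ M._⇒_
    e-homo : Homomorphic₀ L.Carrier M.Carrier M._≈_ f L.e M.e

  open IsLatticeIsomorphism isLatticeIsomorphism public

infix 4 _≅_

_≅_ : Rel (CommutativeResiduatedLattice c ℓ) (c ⊔ ℓ)
L ≅ M = Σ (Carrier L → Carrier M) (IsIsomorphism L M)
  where open CommutativeResiduatedLattice

≅-refl : {L : CommutativeResiduatedLattice c ℓ} → L ≅ L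
≅-refl {L = L} = (λ x → x) , record
  { isLatticeIsomorphism = Identity.isLatticeIsomorphism rawLattice refl
  ; ·-homo = λ _ _ → refl
  ; ⇒-homo = λ _ _ → refl
  ; e-homo = refl
  }
  where
  open CommutativeResiduatedLattice L
  open Setoid setoid using (refl)

≅-trans : {L M N : CommutativeResiduatedLattice c ℓ} → L ≅ M → M ≅ N → L ≅ N
≅-trans {N = N} (f , f-iso) (g , g-iso) = g ∘ f , record
  { isLatticeIsomorphism = Composition.isLatticeIsomorphism trans
      F.isLatticeIsomorphism G.isLatticeIsomorphism
  ; ·-homo = λ x y → trans (G.⟦⟧-cong (F.·-homo x y)) (G.·-homo (f x) (f y))
  ; ⇒-homo = λ x y → trans (G.⟦⟧-cong (F.⇒-homo x y)) (G.⇒-homo (f x) (f y))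
  ; e-homo = trans (G.⟦⟧-cong F.e-homo) G.e-homo
  }
  where
  open Setoid (CommutativeResiduatedLattice.setoid N) using (trans)
  module F = IsIsomorphism f-iso
  module G = IsIsomorphism g-iso

≅-sym : {L M : CommutativeResiduatedLattice c ℓ} → L ≅ M → M ≅ L
≅-sym {L = L} {M = M} (f , f-iso) = g , record
  { isLatticeIsomorphism = record
    { isLatticeMonomorphism = record
      { isLatticeHomomorphism = record
        { isRelHomomorphism = record { cong = g-cong }
        ; ∧-homo = homo L._∧_ M._∧_ (Lattice.∧-cong M.lattice) F.∧-homo
        ; ∨-homo = homo L._∨_ M._∨_ (Lattice.∨-cong M.lattice) F.∨-homo
        }
      ; injective = λ {x} {y} gx≈gy →
          Y.trans (Y.sym (fg x)) (Y.trans (F.⟦⟧-cong gx≈gy) (fg y))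
      }
    ; surjective = λ x → f x , λ z≈fx →
        F.injective (Y.trans (fg _) z≈fx)
    }
  ; ·-homo = homo L._·_ M._·_ M.·-cong F.·-homo
  ; ⇒-homo = homo L._⇒_ M._⇒_ M.⇒-cong F.⇒-homo
  ; e-homo = F.injective (Y.trans (fg M.e) (Y.sym F.e-homo))
  }
  where
  module L = CommutativeResiduatedLattice L
  module M = CommutativeResiduatedLattice M
  module F = IsIsomorphism f-iso
  module X = Setoid L.setoid
  module Y = Setoid M.setoid

  g : M.Carrier → L.Carrier
  g y = proj₁ (F.surjective y)

  fg : ∀ y → f (g y) M.≈ y
  fg y = proj₂ (F.surjective y) X.refl

  g-cong : ∀ {x y} → x M.≈ y → g x L.≈ g y
  g-cong x≈y = F.injective (Y.trans (fg _) (Y.trans x≈y (Y.sym (fg _))))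

  homo : (_∙_ : Op₂ L.Carrier) (_∘′_ : Op₂ M.Carrier) →
         (∀ {x y u v} → x M.≈ y → u M.≈ v → (x ∘′ u) M.≈ (y ∘′ v)) →
         Homomorphic₂ L.Carrier M.Carrier M._≈_ f _∙_ _∘′_ →
         Homomorphic₂ M.Carrier L.Carrier L._≈_ g _∘′_ _∙_
  homo _∙_ _∘′_ ∘-cong f-homo x y = F.injective (begin
    f (g (x ∘′ y))       ≈⟨ fg (x ∘′ y) ⟩
    x ∘′ y               ≈⟨ ∘-cong (fg x) (fg y) ⟨
    f (g x) ∘′ f (g y)   ≈⟨ f-homo (g x) (g y) ⟨
    f (g x ∙ g y)        ∎)
    where open ≈-Reasoning M.setoid

------------------------------------------------------------------------
-- Counting

-- Elements are counted up to the setoid's equality.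
HasCardinality : Setoid c ℓ → ℕ → Set (c ⊔ ℓ)
HasCardinality S n = Bijection (≡.setoid (Fin n)) S

record FiniteConservativeCRL (c ℓ : Level) (n : ℕ) : Set (suc (c ⊔ ℓ)) where
  field
    crl            : CommutativeResiduatedLattice c ℓ
    conservative   : Conservative crl
    hasCardinality : HasCardinality (CommutativeResiduatedLattice.setoid crl) n

-- Equality is isomorphism of the underlying algebras; the chosen enumerations
-- of their elements are ignored.  Hence the cardinality of this setoid is the
-- number of n-element algebras up to isomorphism.
finiteConservativeCRLs : (c ℓ : Level) → ℕ → Setoid (suc (c ⊔ ℓ)) (c ⊔ ℓ)
finiteConservativeCRLs c ℓ n = record
  { Carrier       = FiniteConservativeCRL c ℓ n
  ; _≈_           = λ A B → crl A ≅ crl B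
  ; isEquivalence = record
    { refl  = ≅-refl
    ; sym   = ≅-sym
    ; trans = ≅-trans
    }
  }
  where open FiniteConservativeCRL

-- _/_ truncates, but suc k always divides (2 * k) C k.
catalan : ℕ → ℕ
catalan k = ((2 * k) C k) / ℕ.suc k

{-# OPTIONS --safe #-}
-- In a conservative commutative residuated lattice with n elements the product
-- is the meet of a linear order with top e.  Listing this chain downwards from
-- e = 0 turns the product into max on {0, …, n - 1}, the numbering is rigid, and
-- the algebra is determined by its join: any semilattice operation with neutral
-- element n - 1 over which max distributes.  Removing 0 leaves a join of the same
-- kind, and the join can be recovered from the remaining one together with the
-- largest element d strictly below 0 (in the lattice order); d can be any element
-- below the old 0.  The elements below 0 always form a chain, so an algebra in
-- which this chain has h elements has h extensions, with chains of 2, …, h + 1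
-- elements.  This is the generating tree of the Catalan numbers.
module Submission where

open import Defs
open import Algebra.Bundles using (RawMonoid)
open import Algebra.Core using (Op₂)
open import Algebra.Definitions
  using (Associative; Commutative; Idempotent; Selective; LeftIdentity; _DistributesOverˡ_)
open import Algebra.Lattice.Bundles using (Lattice; RawLattice)
import Algebra.Lattice.Morphism.LatticeMonomorphism as LatticeMonomorphism
import Algebra.Lattice.Properties.Lattice as LatticeProperties
open import Algebra.Lattice.Structures using (IsLattice; IsSemilattice)
import Algebra.Morphism.MonoidMonomorphism as MonoidMonomorphism
open import Algebra.Structures using (IsCommutativeMonoid)
open import Data.Bool.Base using (if_then_else_)
open import Data.Empty using (⊥-elim)
open import Data.Fin.Base using (Fin; zero; suc; fromℕ; cast)
import Data.Fin.Properties as Fin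
open import Data.List.Base using (List; _∷_; length; lookup; tabulate; foldr; filter; allFin)
open import Data.List.Membership.Propositional using (lose)
open import Data.List.Membership.Propositional.Properties using (∈-allFin; ∈-filter⁺; ∈-lookup)
open import Data.List.Properties
  using (foldr-preservesᵇ; foldr-preservesᵒ; length-tabulate; lookup-tabulate)
import Data.List.Relation.Binary.Permutation.Homogeneous as Permutation
import Data.List.Relation.Binary.Permutation.Setoid.Properties as PermutationProperties
import Data.List.Relation.Unary.All as All
open import Data.List.Relation.Unary.All.Properties using (all-filter)
open import Data.List.Relation.Unary.AllPairs using (AllPairs; _∷_)
open import Data.List.Relation.Unary.Linked.Properties using (Linked⇒AllPairs)
import Data.List.Sort as Sort
import Data.List.Sort.Base as SortBase
open import Data.Nat.Base using (ℕ; zero; suc; _+_; _*_; _∸_; _≤_; z≤n; s≤s)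
open import Data.Nat.Combinatorics
  using (_C_; k>n⇒nCk≡0; nCk≡nC[n∸k]; nCn≡1; nC1≡n; nCk+nC[k+1]≡[n+1]C[k+1])
open import Data.Nat.DivMod using (_/_; m*n/n≡m)
import Data.Nat.Properties as ℕ
open import Data.Nat.Tactic.RingSolver using (solve-∀)
open import Data.Product.Base using (Σ; ∃; _×_; _,_; proj₁; proj₂)
open import Data.Sum.Base using (_⊎_; inj₁; inj₂; [_,_]′)
open import Data.Sum.Function.Propositional using (_⊎-↔_)
open import Data.Vec.Base as Vec using (Vec; []; _∷_; head; tail)
open import Function.Base using (_∘_; id)
open import Function.Bundles
  using (_↔_; mk↔ₛ′; mk⇔; Bijection; Equivalence; Inverse)
open import Function.Construct.Composition using (_↔-∘_; bijection)
open import Function.Definitions using (Congruent; Injective)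
open import Function.Properties.Inverse using (Inverse⇒Bijection)
open import Level using (Level; 0ℓ; Lift; lift) renaming (lower to unlift)
open import Relation.Binary.Bundles using (Setoid; Poset; DecTotalOrder)
import Relation.Binary.Construct.Flip.EqAndOrd as Flip
import Relation.Binary.Construct.NaturalOrder.Right as NaturalOrder
import Relation.Binary.Definitions as Binary
import Relation.Binary.Lattice as Order
import Relation.Binary.Lattice.Properties.JoinSemilattice as JoinProperties
import Relation.Binary.Lattice.Properties.Lattice as OrderLatticeProperties
open import Relation.Binary.PropositionalEquality as ≡
  using (_≡_; _≢_; refl; sym; trans; cong; cong₂; subst; module ≡-Reasoning)
import Relation.Binary.Reasoning.Setoid as ≈-Reasoning
open import Relation.Nullary using (¬_; Dec; yes; no; does)
open import Relation.Nullary.Decidable using (_×-dec_; map′; dec-true; dec-false)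
open import Relation.Unary using (Pred; Decidable)

private variable
  n h : ℕ
  c ℓ : Level

-- Ballot paths

-- The index `n` counts the pushes and `h` is the final height. A `drop` starts from positive
-- height, so `Path n 0` consists of the Dyck paths with `n` pushes.
data Path : ℕ → ℕ → Set where
  []   : Path 0 0
  push : ∀ {n h} → Path n h → Path (suc n) (suc h)
  drop : ∀ {n h} → Path n (suc h) → Path n h

-- Paths counted by their number k of drops and their final height h, split
-- according to the last step.
ballot : ℕ → ℕ → ℕ
ballot zero    h       = 1
ballot (suc k) zero    = ballot k 1
ballot (suc k) (suc h) = ballot (suc k) h + ballot k (suc (suc h))

height≤size : ∀ {n h} → Path n h → h ≤ n
height≤size []       = z≤n
height≤size (push p) = s≤s (height≤size p)
height≤size (drop p) = ℕ.<⇒≤ (height≤size p)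

ascent : ∀ h → Path h h
ascent zero    = []
ascent (suc h) = push (ascent h)

-- A final `drop` would have to come from a path higher than its number of pushes.
ascent-unique : ∀ {n h} → n ≤ h → (p q : Path n h) → p ≡ q
ascent-unique n≤h (drop p) q        = ⊥-elim (ℕ.<⇒≱ (height≤size p) n≤h)
ascent-unique n≤h p        (drop q) = ⊥-elim (ℕ.<⇒≱ (height≤size q) n≤h)
ascent-unique n≤h []       []       = refl
ascent-unique n≤h (push p) (push q) = cong push (ascent-unique (ℕ.≤-pred n≤h) p q)

last-drop : ∀ {n} → Path (suc n) 1 ↔ Path (suc n) 0
last-drop = mk↔ₛ′ drop (λ { (drop p) → p }) (λ { (drop p) → refl }) (λ _ → refl)

last-step : ∀ {n h} → (Path n h ⊎ Path (suc n) (suc (suc h))) ↔ Path (suc n) (suc h)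
last-step = mk↔ₛ′
  (λ { (inj₁ p) → push p ; (inj₂ p) → drop p })
  (λ { (push p) → inj₁ p ; (drop p) → inj₂ p })
  (λ { (push p) → refl ; (drop p) → refl })
  (λ { (inj₁ p) → refl ; (inj₂ p) → refl })

-- Induction on the number `k` of drops and the height `h`: without drops only the ascent is left,
-- at height zero the last step is a drop, and otherwise both last steps occur and the counts add
-- up.
enumerate : ∀ k h {n} → h + k ≡ n → Fin (ballot k h) ↔ Path n h
enumerate zero h eq with trans (sym (ℕ.+-identityʳ h)) eq
... | refl = mk↔ₛ′ (λ _ → ascent h) (λ _ → zero)
  (ascent-unique ℕ.≤-refl (ascent h)) (λ { zero → refl })
enumerate (suc k) zero refl = last-drop ↔-∘ enumerate k 1 refl
enumerate (suc k) (suc h) refl =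
  last-step ↔-∘
  ((enumerate (suc k) h refl ⊎-↔ enumerate k (suc (suc h)) (cong suc (sym (ℕ.+-suc h k)))) ↔-∘
   Fin.+↔⊎)

-- Binomial identities and the Catalan formula

nC0≡1 : ∀ n → n C 0 ≡ 1
nC0≡1 n = trans (nCk≡nC[n∸k] {0} {n} z≤n) (nCn≡1 n)

-- This is `n C (k - 1)` with value 0 at `k = 0`, which makes Pascal's rule and the reflection
-- formula uniform in `k`.
_C⁻_ : ℕ → ℕ → ℕ
n C⁻ zero  = 0
n C⁻ suc k = n C k

C⁻-pascal : ∀ n k → n C⁻ k + n C k ≡ suc n C k
C⁻-pascal n zero    = trans (nC0≡1 n) (sym (nC0≡1 (suc n)))
C⁻-pascal n (suc k) = nCk+nC[k+1]≡[n+1]C[k+1] n k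

[2k+1]C[k+1]≡[2k+1]Ck : ∀ k → (2 * k + 1) C suc k ≡ (2 * k + 1) C k
[2k+1]C[k+1]≡[2k+1]Ck k = trans
  (nCk≡nC[n∸k] {suc k} (subst (suc k ≤_) (sym split) (ℕ.m≤m+n (suc k) k)))
  (cong ((2 * k + 1) C_) (trans (cong (_∸ suc k) split) (ℕ.m+n∸m≡n (suc k) k)))
  where
  split : 2 * k + 1 ≡ suc k + k
  split = 2k+1≡ k
    where
    2k+1≡ : ∀ k → 2 * k + 1 ≡ suc k + k
    2k+1≡ = solve-∀

-- The reflection principle.
ballot-closed : ∀ k h → ballot k h + (2 * k + h) C⁻ k ≡ (2 * k + h) C k
ballot-closed zero h = sym (nC0≡1 h)
ballot-closed (suc k) zero = begin
  ballot k 1 + (2 * suc k + 0) C k  ≡⟨ cong (λ m → ballot k 1 + m C k) 2k+2 ⟩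
  ballot k 1 + suc N C k            ≡⟨ cong (ballot k 1 +_) (C⁻-pascal N k) ⟨
  ballot k 1 + (N C⁻ k + N C k)     ≡⟨ ℕ.+-assoc (ballot k 1) _ _ ⟨
  (ballot k 1 + N C⁻ k) + N C k     ≡⟨ cong (_+ N C k) (ballot-closed k 1) ⟩
  N C k + N C k                     ≡⟨ cong (N C k +_) ([2k+1]C[k+1]≡[2k+1]Ck k) ⟨
  N C k + N C suc k                 ≡⟨ nCk+nC[k+1]≡[n+1]C[k+1] N k ⟩
  suc N C suc k                     ≡⟨ cong (_C suc k) 2k+2 ⟨
  (2 * suc k + 0) C suc k           ∎
  where
  open ≡-Reasoning
  N = 2 * k + 1
  shift : ∀ k → 2 * suc k + 0 ≡ suc (2 * k + 1)
  shift = solve-∀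
  2k+2 = shift k
ballot-closed (suc k) (suc h) = begin
  (b + b′) + (2 * suc k + suc h) C k  ≡⟨ cong (λ m → (b + b′) + m C k) (ℕ.+-suc (2 * suc k) h) ⟩
  (b + b′) + suc N C k                ≡⟨ cong ((b + b′) +_) (C⁻-pascal N k) ⟨
  (b + b′) + (N C⁻ k + N C k)         ≡⟨ shuffle b b′ (N C⁻ k) (N C k) ⟩
  (b′ + N C⁻ k) + (b + N C k)         ≡⟨ cong₂ _+_ closed′ (ballot-closed (suc k) h) ⟩
  N C k + N C suc k                   ≡⟨ nCk+nC[k+1]≡[n+1]C[k+1] N k ⟩
  suc N C suc k                       ≡⟨ cong (_C suc k) (ℕ.+-suc (2 * suc k) h) ⟨
  (2 * suc k + suc h) C suc k         ∎
  where
  open ≡-Reasoning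
  N = 2 * suc k + h
  b = ballot (suc k) h
  b′ = ballot k (suc (suc h))
  shuffle : ∀ a b c d → (a + b) + (c + d) ≡ (b + c) + (a + d)
  shuffle = solve-∀
  shift : ∀ k h → 2 * k + suc (suc h) ≡ 2 * suc k + h
  shift = solve-∀
  closed′ : b′ + N C⁻ k ≡ N C k
  closed′ = subst (λ m → b′ + m C⁻ k ≡ m C k) (shift k h) (ballot-closed k (suc (suc h)))

C-absorption : ∀ n k → suc k * (suc n C suc k) ≡ suc n * (n C k)
C-absorption n zero = begin
  1 * (suc n C 1)        ≡⟨ ℕ.*-identityˡ _ ⟩
  suc n C 1              ≡⟨ nC1≡n (suc n) ⟩
  suc n                  ≡⟨ ℕ.*-identityʳ _ ⟨
  suc n * 1              ≡⟨ cong (suc n *_) (nC0≡1 n) ⟨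
  suc n * (n C 0)        ∎
  where open ≡-Reasoning
C-absorption zero (suc k) = begin
  suc (suc k) * (1 C suc (suc k))  ≡⟨ cong (suc (suc k) *_) (k>n⇒nCk≡0 {k = suc (suc k)} (s≤s (s≤s z≤n))) ⟩
  suc (suc k) * 0                  ≡⟨ ℕ.*-zeroʳ (suc (suc k)) ⟩
  0                                ≡⟨ cong (1 *_) (k>n⇒nCk≡0 {k = suc k} (s≤s z≤n)) ⟨
  1 * (0 C suc k)                  ∎
  where open ≡-Reasoning
C-absorption (suc n) (suc k) = begin
  suc (suc k) * (suc (suc n) C suc (suc k))
    ≡⟨ cong (suc (suc k) *_) (nCk+nC[k+1]≡[n+1]C[k+1] (suc n) (suc k)) ⟨
  suc (suc k) * (a + b)
    ≡⟨ expand k a b ⟩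
  a + (suc k * a + suc (suc k) * b)
    ≡⟨ cong (a +_) (cong₂ _+_ (C-absorption n k) (C-absorption n (suc k))) ⟩
  a + (suc n * (n C k) + suc n * (n C suc k))
    ≡⟨ cong (a +_) (ℕ.*-distribˡ-+ (suc n) (n C k) (n C suc k)) ⟨
  a + suc n * (n C k + n C suc k)
    ≡⟨ cong (λ x → a + suc n * x) (nCk+nC[k+1]≡[n+1]C[k+1] n k) ⟩
  suc (suc n) * a
    ∎
  where
  open ≡-Reasoning
  a = suc n C suc k
  b = suc n C suc (suc k)
  expand : ∀ k a b → suc (suc k) * (a + b) ≡ a + (suc k * a + suc (suc k) * b)
  expand = solve-∀

-- After adding `suc k * low` to both sides, the claim is Pascal's rule followed by absorption for
-- the entry `suc (2 * suc k) C suc k`.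
central-C-ratio : ∀ k → suc k * ((2 * suc k) C suc k) ≡ suc (suc k) * ((2 * suc k) C k)
central-C-ratio k = ℕ.+-cancelʳ-≡ (suc k * low) _ _ (begin
  suc k * mid + suc k * low    ≡⟨ ℕ.+-comm (suc k * mid) _ ⟩
  suc k * low + suc k * mid    ≡⟨ ℕ.*-distribˡ-+ (suc k) low mid ⟨
  suc k * (low + mid)          ≡⟨ cong (suc k *_) (nCk+nC[k+1]≡[n+1]C[k+1] (2 * suc k) k) ⟩
  suc k * (suc (2 * suc k) C suc k)  ≡⟨ C-absorption (2 * suc k) k ⟩
  suc (2 * suc k) * low       ≡⟨ split k low ⟩
  suc (suc k) * low + suc k * low ∎)
  where
  open ≡-Reasoning
  low = (2 * suc k) C k
  mid = (2 * suc k) C suc k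
  split : ∀ k low → suc (2 * suc k) * low ≡ suc (suc k) * low + suc k * low
  split = solve-∀

-- For positive `k` the reflection formula gives a difference of two neighbouring binomials, whose
-- ratio is `central-C-ratio`. The subtracted binomial stays on the other side to avoid truncated
-- subtraction.
[k+1]*ballot : ∀ k → suc k * ballot k 0 ≡ (2 * k) C k
[k+1]*ballot zero    = refl
[k+1]*ballot (suc k) = ℕ.+-cancelʳ-≡ (suc (suc k) * low) _ _ (begin
  suc (suc k) * ballot k 1 + suc (suc k) * low  ≡⟨ ℕ.*-distribˡ-+ (suc (suc k)) (ballot k 1) low ⟨
  suc (suc k) * (ballot k 1 + low)              ≡⟨ cong (suc (suc k) *_) closed ⟩
  mid + suc k * mid                             ≡⟨ cong (mid +_) (central-C-ratio k) ⟩
  mid + suc (suc k) * low                        ∎)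
  where
  open ≡-Reasoning
  low = (2 * suc k) C k
  mid = (2 * suc k) C suc k
  closed : ballot k 1 + low ≡ mid
  closed = subst (λ m → ballot k 1 + m C k ≡ m C suc k) (ℕ.+-identityʳ (2 * suc k))
    (ballot-closed (suc k) 0)

ballot≡catalan : ∀ k → ballot k 0 ≡ catalan k
ballot≡catalan k = begin
  ballot k 0                  ≡⟨ m*n/n≡m (ballot k 0) (suc k) ⟨
  ballot k 0 * suc k / suc k  ≡⟨ cong (_/ suc k) (ℕ.*-comm (ballot k 0) (suc k)) ⟩
  suc k * ballot k 0 / suc k  ≡⟨ cong (_/ suc k) ([k+1]*ballot k) ⟩
  catalan k                   ∎
  where open ≡-Reasoning

-- Joins on the chain

max : Op₂ (Fin n)
max zero    y       = y
max (suc x) zero    = suc x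
max (suc x) (suc y) = suc (max x y)

max-comm : Commutative {A = Fin n} _≡_ max
max-comm zero    zero    = refl
max-comm zero    (suc y) = refl
max-comm (suc x) zero    = refl
max-comm (suc x) (suc y) = cong suc (max-comm x y)

max-assoc : Associative {A = Fin n} _≡_ max
max-assoc zero    y       z       = refl
max-assoc (suc x) zero    z       = refl
max-assoc (suc x) (suc y) zero    = refl
max-assoc (suc x) (suc y) (suc z) = cong suc (max-assoc x y z)

max-sel : Selective {A = Fin n} _≡_ max
max-sel zero    y       = inj₂ refl
max-sel (suc x) zero    = inj₁ refl
max-sel (suc x) (suc y) with max-sel x y
... | inj₁ eq = inj₁ (cong suc eq)
... | inj₂ eq = inj₂ (cong suc eq)

max-identityʳ : (x : Fin (suc n)) → max x zero ≡ x
max-identityʳ zero    = refl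
max-identityʳ (suc x) = refl

max-zeroʳ : (x : Fin (suc n)) → max x (fromℕ n) ≡ fromℕ n
max-zeroʳ         zero    = refl
max-zeroʳ {suc n} (suc x) = cong suc (max-zeroʳ x)

infix 4 _≤[_]_

_≤[_]_ : {A : Set} → A → Op₂ A → A → Set
x ≤[ J ] y = J x y ≡ y

-- Only the join is recorded: by finiteness, meets and residuals arise from it as greatest elements.
-- `identityˡ` makes the last index, the zero of `max`, the least element, and `distribˡ` is what
-- residuation demands of the product.
record IsJoin (J : Op₂ (Fin (suc n))) : Set where
  field
    assoc     : Associative _≡_ J
    comm      : Commutative _≡_ J
    idem      : Idempotent _≡_ J
    identityˡ : LeftIdentity _≡_ (fromℕ n) J
    distribˡ  : _DistributesOverˡ_ _≡_ max J

  ≤-trans : ∀ {x y z} → x ≤[ J ] y → y ≤[ J ] z → x ≤[ J ] z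
  ≤-trans {x} {y} {z} x≤y y≤z = begin
    J x z        ≡⟨ cong (J x) y≤z ⟨
    J x (J y z)  ≡⟨ assoc x y z ⟨
    J (J x y) z  ≡⟨ cong (λ w → J w z) x≤y ⟩
    J y z        ≡⟨ y≤z ⟩
    z            ∎
    where open ≡-Reasoning

  ≤-antisym : ∀ {x y} → x ≤[ J ] y → y ≤[ J ] x → x ≡ y
  ≤-antisym {x} {y} x≤y y≤x = trans (sym y≤x) (trans (comm y x) x≤y)

  x≤x∨y : ∀ x y → x ≤[ J ] J x y
  x≤x∨y x y = trans (sym (assoc x x y)) (cong (λ w → J w y) (idem x))

  y≤x∨y : ∀ x y → y ≤[ J ] J x y
  y≤x∨y x y = subst (y ≤[ J ]_) (comm y x) (x≤x∨y y x)

  ∨-least : ∀ {x y z} → x ≤[ J ] z → y ≤[ J ] z → J x y ≤[ J ] z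
  ∨-least {x} {y} {z} x≤z y≤z = trans (assoc x y z) (trans (cong (J x) y≤z) x≤z)

  -- The witness is the join of all elements satisfying `P`. Meets, residuals and the element `d` of
  -- an extension are all found this way.
  greatest : {P : Pred (Fin (suc n)) 0ℓ} → Decidable P → P (fromℕ n) →
             (∀ {x y} → P x → P y → P (J x y)) →
             ∃ λ m → P m × (∀ {x} → P x → x ≤[ J ] m)
  greatest P? Pbot P∨ =
    foldr J (fromℕ n) ps ,
    foldr-preservesᵇ P∨ Pbot (all-filter P? (allFin _)) ,
    λ {x} Px → foldr-preservesᵒ
      (λ y z → [ (λ x≤y → ≤-trans x≤y (x≤x∨y y z)) , (λ x≤z → ≤-trans x≤z (y≤x∨y y z)) ]′)
      (fromℕ n) ps (inj₂ (lose (∈-filter⁺ P? (∈-allFin x) Px) (idem x)))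
    where ps = filter P? (allFin _)

-- A new neutral element zero is adjoined on top of the chain; d, which lies
-- below the old one, becomes the largest element strictly below the new one.
extend : Op₂ (Fin (suc n)) → Fin (suc n) → Op₂ (Fin (suc (suc n)))
extend J d zero    zero    = zero
extend J d zero    (suc x) = if does (J x d Fin.≟ d) then zero else suc (J zero x)
extend J d (suc x) zero    = if does (J x d Fin.≟ d) then zero else suc (J zero x)
extend J d (suc x) (suc y) = suc (J x y)

module _ (J : Op₂ (Fin (suc n))) {d : Fin (suc n)} where

  extend-≤ : ∀ {x} → x ≤[ J ] d → extend J d zero (suc x) ≡ zero
  extend-≤ {x} x≤d =
    cong (λ b → if b then zero else suc (J zero x)) (dec-true (J x d Fin.≟ d) x≤d)

  extend-≰ : ∀ {x} → ¬ x ≤[ J ] d → extend J d zero (suc x) ≡ suc (J zero x)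
  extend-≰ {x} x≰d =
    cong (λ b → if b then zero else suc (J zero x)) (dec-false (J x d Fin.≟ d) x≰d)

  extend-≤⁻ : ∀ {x} → extend J d zero (suc x) ≡ zero → x ≤[ J ] d
  extend-≤⁻ {x} eq with J x d Fin.≟ d
  ... | yes x≤d = x≤d
  extend-≤⁻ {x} () | no _

  extend-comm : Commutative _≡_ J → Commutative _≡_ (extend J d)
  extend-comm J-comm zero    zero    = refl
  extend-comm J-comm zero    (suc y) = refl
  extend-comm J-comm (suc x) zero    = refl
  extend-comm J-comm (suc x) (suc y) = cong suc (J-comm x y)

module _ {J : Op₂ (Fin (suc n))} (J-isJoin : IsJoin J) {d : Fin (suc n)} (d≤0 : d ≤[ J ] zero) where
  private
    module J = IsJoin J-isJoin
    J′ = extend J d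

    comm′ : Commutative _≡_ J′
    comm′ = extend-comm J J.comm

    assoc₀₀ : ∀ x → J′ zero (suc x) ≡ J′ zero (J′ zero (suc x))
    assoc₀₀ x = helper (J x d Fin.≟ d)
      where
      helper : Dec (x ≤[ J ] d) → J′ zero (suc x) ≡ J′ zero (J′ zero (suc x))
      helper (yes x≤d) rewrite extend-≤ J x≤d = refl
      helper (no x≰d) = begin
        J′ zero (suc x)            ≡⟨ extend-≰ J x≰d ⟩
        suc (J zero x)             ≡⟨ cong suc (J.x≤x∨y zero x) ⟨
        suc (J zero (J zero x))    ≡⟨ extend-≰ J (λ q → x≰d (J.≤-trans (J.y≤x∨y zero x) q)) ⟨
        J′ zero (suc (J zero x))   ≡⟨ cong (J′ zero) (extend-≰ J x≰d) ⟨
        J′ zero (J′ zero (suc x))  ∎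
        where open ≡-Reasoning

    -- Being below `d` passes to smaller elements and to joins, so `J x y` is below `d` exactly when
    -- `x` and `y` both are.
    assoc₀ : ∀ x y → J′ (J′ zero (suc x)) (suc y) ≡ J′ zero (suc (J x y))
    assoc₀ x y = helper (J x d Fin.≟ d) (J y d Fin.≟ d)
      where
      open ≡-Reasoning
      helper : Dec (x ≤[ J ] d) → Dec (y ≤[ J ] d) →
               J′ (J′ zero (suc x)) (suc y) ≡ J′ zero (suc (J x y))
      helper (yes x≤d) (yes y≤d) = begin
        J′ (J′ zero (suc x)) (suc y)  ≡⟨ cong (λ w → J′ w (suc y)) (extend-≤ J x≤d) ⟩
        J′ zero (suc y)               ≡⟨ extend-≤ J y≤d ⟩
        zero                          ≡⟨ extend-≤ J (J.∨-least x≤d y≤d) ⟨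
        J′ zero (suc (J x y))         ∎
      helper (yes x≤d) (no y≰d) = begin
        J′ (J′ zero (suc x)) (suc y)  ≡⟨ cong (λ w → J′ w (suc y)) (extend-≤ J x≤d) ⟩
        J′ zero (suc y)               ≡⟨ extend-≰ J y≰d ⟩
        -- From `x` below `d` and `d` below the old `zero`, the old `zero` absorbs `x` too.
        suc (J zero y)                ≡⟨ cong (λ w → suc (J w y)) (trans (J.comm zero x) (J.≤-trans x≤d d≤0)) ⟨
        suc (J (J zero x) y)          ≡⟨ cong suc (J.assoc zero x y) ⟩
        suc (J zero (J x y))          ≡⟨ extend-≰ J (λ q → y≰d (J.≤-trans (J.y≤x∨y x y) q)) ⟨
        J′ zero (suc (J x y))         ∎
      helper (no x≰d) _ = begin
        J′ (J′ zero (suc x)) (suc y)  ≡⟨ cong (λ w → J′ w (suc y)) (extend-≰ J x≰d) ⟩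
        suc (J (J zero x) y)          ≡⟨ cong suc (J.assoc zero x y) ⟩
        suc (J zero (J x y))          ≡⟨ extend-≰ J (λ q → x≰d (J.≤-trans (J.x≤x∨y x y) q)) ⟨
        J′ zero (suc (J x y))         ∎

    assoc′ : Associative _≡_ J′
    assoc′ zero    zero    zero    = refl
    assoc′ zero    zero    (suc z) = assoc₀₀ z
    assoc′ zero    (suc y) zero    = comm′ (J′ zero (suc y)) zero
    assoc′ zero    (suc y) (suc z) = assoc₀ y z
    assoc′ (suc x) zero    zero    = trans (comm′ (J′ (suc x) zero) zero) (sym (assoc₀₀ x))
    assoc′ (suc x) zero    (suc z) = begin
      J′ (J′ zero (suc x)) (suc z)  ≡⟨ assoc₀ x z ⟩
      J′ zero (suc (J x z))         ≡⟨ cong (J′ zero ∘ suc) (J.comm x z) ⟩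
      J′ zero (suc (J z x))         ≡⟨ assoc₀ z x ⟨
      J′ (J′ zero (suc z)) (suc x)  ≡⟨ comm′ (J′ zero (suc z)) (suc x) ⟩
      J′ (suc x) (J′ zero (suc z))  ∎
      where open ≡-Reasoning
    assoc′ (suc x) (suc y) zero    = begin
      J′ zero (suc (J x y))         ≡⟨ cong (J′ zero ∘ suc) (J.comm x y) ⟩
      J′ zero (suc (J y x))         ≡⟨ assoc₀ y x ⟨
      J′ (J′ zero (suc y)) (suc x)  ≡⟨ comm′ (J′ zero (suc y)) (suc x) ⟩
      J′ (suc x) (J′ zero (suc y))  ∎
      where open ≡-Reasoning
    assoc′ (suc x) (suc y) (suc z) = cong suc (J.assoc x y z)

    -- Distributivity of `J` at the old `zero` and `z` serves both cases: if `z` is below `d`, then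
    -- `J zero z` is the old `zero`, which is as neutral for `max` as the new one.
    distrib₀ : ∀ k z → suc (J k (max k z)) ≡ max (suc k) (J′ zero (suc z))
    distrib₀ k z = helper (J z d Fin.≟ d)
      where
      open ≡-Reasoning
      distrib : max k (J zero z) ≡ J k (max k z)
      distrib = trans (J.distribˡ k zero z) (cong (λ w → J w (max k z)) (max-identityʳ k))
      helper : Dec (z ≤[ J ] d) → suc (J k (max k z)) ≡ max (suc k) (J′ zero (suc z))
      helper (yes z≤d) = begin
        suc (J k (max k z))            ≡⟨ cong suc distrib ⟨
        suc (max k (J zero z))         ≡⟨ cong (suc ∘ max k) (trans (J.comm zero z) (J.≤-trans z≤d d≤0)) ⟩
        suc (max k zero)               ≡⟨ cong suc (max-identityʳ k) ⟩
        suc k                          ≡⟨ cong (max (suc k)) (extend-≤ J z≤d) ⟨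
        max (suc k) (J′ zero (suc z))  ∎
      helper (no z≰d) = begin
        suc (J k (max k z))            ≡⟨ cong suc distrib ⟨
        suc (max k (J zero z))         ≡⟨ cong (max (suc k)) (extend-≰ J z≰d) ⟨
        max (suc k) (J′ zero (suc z))  ∎

    distrib′ : _DistributesOverˡ_ _≡_ max J′
    distrib′ zero    y       z       = refl
    distrib′ (suc k) zero    zero    = sym (cong suc (J.idem k))
    distrib′ (suc k) zero    (suc z) = sym (distrib₀ k z)
    distrib′ (suc k) (suc y) zero    = sym (trans (cong suc (J.comm (max k y) k)) (distrib₀ k y))
    distrib′ (suc k) (suc y) (suc z) = cong suc (J.distribˡ k y z)

  extend-isJoin : IsJoin J′
  extend-isJoin = record
    { assoc     = assoc′
    ; comm      = comm′
    ; idem      = λ { zero → refl ; (suc x) → cong suc (J.idem x) }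
    ; identityˡ = λ { zero → extend-≤ J (J.identityˡ d) ; (suc x) → cong suc (J.identityˡ x) }
    ; distribˡ  = distrib′
    }

-- Decoding paths into joins

trivial-isJoin : IsJoin {0} (λ _ _ → zero)
trivial-isJoin = record
  { assoc     = λ _ _ _ → refl
  ; comm      = λ _ _ → refl
  ; idem      = λ { zero → refl }
  ; identityˡ = λ { zero → refl }
  ; distribˡ  = λ { zero _ _ → refl }
  }

-- ⟦ p ⟧ is the join encoded by p, and chain p is a final segment of the
-- elements below zero, in descending order.  Pushing extends the join by the
-- head of this segment, dropping removes the head.
⟦_⟧   : Path n h → Op₂ (Fin (suc n))
chain : Path n h → Vec (Fin (suc n)) (suc h)

⟦ []     ⟧ = λ _ _ → zero
⟦ push p ⟧ = extend ⟦ p ⟧ (head (chain p))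
⟦ drop p ⟧ = ⟦ p ⟧

chain []       = zero ∷ []
chain (push p) = zero ∷ Vec.map suc (chain p)
chain (drop p) = tail (chain p)

-- The vector lists all elements below its head, each entry covering the next, down to a minimal
-- one. The down-set of the head is thus a chain whose size is the length of the vector.
data DownSet {A : Set} (J : Op₂ A) : Vec A (suc h) → Set where
  bottom : ∀ {x} → (∀ {z} → z ≤[ J ] x → z ≡ x) → DownSet J (x ∷ [])
  cover  : ∀ {x y} {ys : Vec A h} → y ≤[ J ] x → x ≢ y →
           (∀ {z} → z ≤[ J ] x → z ≡ x ⊎ z ≤[ J ] y) →
           DownSet J (y ∷ ys) → DownSet J (x ∷ y ∷ ys)

module _ {J : Op₂ (Fin (suc n))} (J-isJoin : IsJoin J) {d : Fin (suc n)} where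
  private
    module J = IsJoin J-isJoin
    J′ = extend J d

    -- For `x` below `d`, the new `zero` absorbs `suc x`, so it is not itself below `suc x`.
    below-suc : ∀ {x z} → x ≤[ J ] d → z ≤[ J′ ] suc x →
                ∃ λ w → z ≡ suc w × w ≤[ J ] x
    below-suc {z = zero}  x≤d z≤x with () ← trans (sym (extend-≤ J x≤d)) z≤x
    below-suc {z = suc w} x≤d z≤x = w , refl , Fin.suc-injective z≤x

  DownSet-suc : {v : Vec (Fin (suc n)) (suc h)} → head v ≤[ J ] d →
                DownSet J v → DownSet J′ (Vec.map suc v)
  DownSet-suc x≤d (bottom min) = bottom λ z≤x →
    case-below (below-suc x≤d z≤x)
    where
    case-below : ∀ {z} → (∃ λ w → z ≡ suc w × w ≤[ J ] _) → z ≡ suc _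
    case-below (w , refl , w≤x) = cong suc (min w≤x)
  DownSet-suc x≤d (cover {x = x} {y = y} y≤x x≢y below ds) =
    cover (cong suc y≤x) (x≢y ∘ Fin.suc-injective) (λ z≤x → case-below (below-suc x≤d z≤x))
      (DownSet-suc (J.≤-trans y≤x x≤d) ds)
    where
    case-below : ∀ {z} → (∃ λ w → z ≡ suc w × w ≤[ J ] x) → z ≡ suc x ⊎ z ≤[ J′ ] suc y
    case-below (w , refl , w≤x) with below w≤x
    ... | inj₁ w≡x = inj₁ (cong suc w≡x)
    ... | inj₂ w≤y = inj₂ (cong suc w≤y)

-- The test in `extend` puts exactly the shifts of the elements below `d` strictly below the new
-- `zero`, so the chain grows by one entry.
DownSet-extend : {J : Op₂ (Fin (suc n))} → IsJoin J →
                 {v : Vec (Fin (suc n)) (suc h)} → DownSet J v →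
                 DownSet (extend J (head v)) (zero ∷ Vec.map suc v)
DownSet-extend {J = J} J-isJoin {d ∷ v} ds =
  cover (trans (extend-comm J {d} (IsJoin.comm J-isJoin) (suc d) zero) (extend-≤ J (IsJoin.idem J-isJoin d))) (λ ())
    (λ { {zero}  _   → inj₁ refl
       ; {suc w} w≤0 → inj₂ (cong suc (extend-≤⁻ J w≤0)) })
    (DownSet-suc J-isJoin (IsJoin.idem J-isJoin d) ds)

DownSet-tail : ∀ {A : Set} {J : Op₂ A} {v : Vec A (suc (suc h))} → DownSet J v →
               head (tail v) ≤[ J ] head v × DownSet J (tail v)
DownSet-tail (cover y≤x _ _ ds) = y≤x , ds

-- The three claims need a joint induction: a push yields a join only if the head of the chain is
-- below `zero`, and a drop preserves this because the chain descends.
sound : (p : Path n h) →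
        IsJoin ⟦ p ⟧ × head (chain p) ≤[ ⟦ p ⟧ ] zero × DownSet ⟦ p ⟧ (chain p)
sound [] = trivial-isJoin , refl , bottom λ { {zero} _ → refl }
sound (push p) with isJoin , d≤0 , ds ← sound p =
  extend-isJoin isJoin d≤0 , refl , DownSet-extend isJoin ds
sound (drop p) with isJoin , d≤0 , ds ← sound p with y≤x , ds′ ← DownSet-tail ds =
  isJoin , IsJoin.≤-trans isJoin y≤x d≤0 , ds′

⟦⟧-isJoin : (p : Path n h) → IsJoin ⟦ p ⟧
⟦⟧-isJoin p = proj₁ (sound p)

chain-DownSet : (p : Path n h) → DownSet ⟦ p ⟧ (chain p)
chain-DownSet p = proj₂ (proj₂ (sound p))

-- Injectivity of the decoding

infix 4 _≗₂_

_≗₂_ : {A : Set} → Op₂ A → Op₂ A → Set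
J ≗₂ K = ∀ x y → J x y ≡ K x y

-- The covers are forced: each second entry lies strictly below the common head, hence below the
-- other second entry, and antisymmetry identifies the two.
DownSet-length : {J K : Op₂ (Fin (suc n))} → IsJoin J → J ≗₂ K →
                 ∀ {k} {v : Vec (Fin (suc n)) (suc h)} {w : Vec (Fin (suc n)) (suc k)} →
                 DownSet J v → DownSet K w → head v ≡ head w → h ≡ k
DownSet-length J-isJoin J≗K (bottom _) (bottom _) refl = refl
DownSet-length J-isJoin J≗K (bottom min) (cover y≤x x≢y _ _) refl =
  ⊥-elim (x≢y (sym (min (trans (J≗K _ _) y≤x))))
DownSet-length J-isJoin J≗K (cover y≤x x≢y _ _) (bottom min) refl =
  ⊥-elim (x≢y (sym (min (trans (sym (J≗K _ _)) y≤x))))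
DownSet-length J-isJoin J≗K (cover y≤x x≢y below ds) (cover z≤x x≢z below′ ds′) refl
  with below (trans (J≗K _ _) z≤x) | below′ (trans (sym (J≗K _ _)) y≤x)
... | inj₁ z≡x | _        = ⊥-elim (x≢z (sym z≡x))
... | inj₂ _   | inj₁ y≡x = ⊥-elim (x≢y (sym y≡x))
... | inj₂ z≤y | inj₂ y≤z = cong suc
  (DownSet-length J-isJoin J≗K ds ds′ (IsJoin.≤-antisym J-isJoin (trans (J≗K _ _) y≤z) z≤y))

-- Undoing the trailing drops restores the chain that starts at `zero`, and each drop undone raises
-- the height.
zero-chain : (p : Path n h) → ∃ λ k → h ≤ k ×
             Σ (Vec (Fin (suc n)) (suc k)) λ v → head v ≡ zero × DownSet ⟦ p ⟧ v
zero-chain p@[]       = _ , ℕ.≤-refl , chain p , refl , chain-DownSet p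
zero-chain p@(push _) = _ , ℕ.≤-refl , chain p , refl , chain-DownSet p
zero-chain (drop p) with k , h<k , v , v₀≡0 , ds ← zero-chain p =
  k , ℕ.<⇒≤ h<k , v , v₀≡0 , ds

-- A path ending in a drop has not kept the whole chain below zero.
complete≢drop : (p : Path n h) (q : Path n (suc h)) → head (chain p) ≡ zero → ¬ ⟦ p ⟧ ≗₂ ⟦ q ⟧
complete≢drop p q p₀≡0 p≗q with k , h<k , v , v₀≡0 , ds ← zero-chain q =
  ℕ.<⇒≢ h<k (DownSet-length (⟦⟧-isJoin p) p≗q (chain-DownSet p) ds (trans p₀≡0 (sym v₀≡0)))

-- Equal last steps are peeled off, a push by restricting to successors. Unequal ones are excluded
-- by the common height: one chain still starts at `zero`, while the other has been shortened.
⟦⟧-injective : (p q : Path n h) → ⟦ p ⟧ ≗₂ ⟦ q ⟧ → p ≡ q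
⟦⟧-injective []         []         p≗q = refl
⟦⟧-injective (push p)   (push q)   p≗q =
  cong push (⟦⟧-injective p q λ x y → Fin.suc-injective (p≗q (suc x) (suc y)))
⟦⟧-injective (drop p)   (drop q)   p≗q = cong drop (⟦⟧-injective p q p≗q)
⟦⟧-injective p@[]       (drop q)   p≗q = ⊥-elim (complete≢drop p q refl p≗q)
⟦⟧-injective p@(push _) (drop q)   p≗q = ⊥-elim (complete≢drop p q refl p≗q)
⟦⟧-injective (drop p)   q@[]       p≗q = ⊥-elim (complete≢drop q p refl λ x y → sym (p≗q x y))
⟦⟧-injective (drop p)   q@(push _) p≗q = ⊥-elim (complete≢drop q p refl λ x y → sym (p≗q x y))

-- Recovering a path from a join

lower : Fin (suc (suc n)) → Fin (suc n)
lower zero    = zero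
lower (suc x) = x

-- Expressing truncation through `max` makes `distribˡ` applicable to `lower`.
suc-lower : (x : Fin (suc (suc n))) → suc (lower x) ≡ max (suc zero) x
suc-lower zero    = refl
suc-lower (suc x) = refl

restrict : Op₂ (Fin (suc (suc n))) → Op₂ (Fin (suc n))
restrict J x y = lower (J (suc x) (suc y))

module _ {J : Op₂ (Fin (suc (suc n)))} (J-isJoin : IsJoin J) where
  private
    module J = IsJoin J-isJoin
    J⁻ = restrict J

  -- Truncation max (suc zero) preserves joins, so the chain without its top is
  -- closed under them.
  suc-restrict : ∀ x y → suc (J⁻ x y) ≡ J (suc x) (suc y)
  suc-restrict x y = begin
    suc (J⁻ x y)                                      ≡⟨ suc-lower (J (suc x) (suc y)) ⟩
    max (suc zero) (J (suc x) (suc y))                ≡⟨ J.distribˡ (suc zero) (suc x) (suc y) ⟩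
    J (suc x) (suc y)                                 ∎
    where open ≡-Reasoning

  -- This leaves two values for `J zero (suc x)`, namely `zero` and `suc (J⁻ zero x)`, the two
  -- branches of `extend`.
  lower-J-zero : ∀ x → lower (J zero (suc x)) ≡ J⁻ zero x
  lower-J-zero x = Fin.suc-injective (begin
    suc (lower (J zero (suc x)))        ≡⟨ suc-lower (J zero (suc x)) ⟩
    max (suc zero) (J zero (suc x))     ≡⟨ J.distribˡ (suc zero) zero (suc x) ⟩
    J (suc zero) (suc x)                ≡⟨ suc-restrict zero x ⟨
    suc (J⁻ zero x)                     ∎)
    where open ≡-Reasoning

  restrict-isJoin : IsJoin J⁻
  restrict-isJoin = record
    { assoc     = λ x y z → Fin.suc-injective (begin
        suc (J⁻ (J⁻ x y) z)          ≡⟨ suc-restrict (J⁻ x y) z ⟩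
        J (suc (J⁻ x y)) (suc z)     ≡⟨ cong (λ w → J w (suc z)) (suc-restrict x y) ⟩
        J (J (suc x) (suc y)) (suc z)  ≡⟨ J.assoc (suc x) (suc y) (suc z) ⟩
        J (suc x) (J (suc y) (suc z))  ≡⟨ cong (J (suc x)) (suc-restrict y z) ⟨
        J (suc x) (suc (J⁻ y z))     ≡⟨ suc-restrict x (J⁻ y z) ⟨
        suc (J⁻ x (J⁻ y z))          ∎)
    ; comm      = λ x y → cong lower (J.comm (suc x) (suc y))
    ; idem      = λ x → cong lower (J.idem (suc x))
    ; identityˡ = λ x → cong lower (J.identityˡ (suc x))
    ; distribˡ  = λ k x y → Fin.suc-injective (begin
        suc (max k (J⁻ x y))         ≡⟨ cong (max (suc k)) (suc-restrict x y) ⟩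
        max (suc k) (J (suc x) (suc y))  ≡⟨ J.distribˡ (suc k) (suc x) (suc y) ⟩
        J (suc (max k x)) (suc (max k y))  ≡⟨ suc-restrict (max k x) (max k y) ⟨
        suc (J⁻ (max k x) (max k y))  ∎)
    }
    where open ≡-Reasoning

  ≤-restrict : ∀ {x y} → x ≤[ J⁻ ] y → suc x ≤[ J ] suc y
  ≤-restrict {x} {y} x≤y = trans (sym (suc-restrict x y)) (cong suc x≤y)

  restrict-≤0 : ∀ {x} → suc x ≤[ J ] zero → x ≤[ J⁻ ] zero
  restrict-≤0 {x} x≤0 = trans (IsJoin.comm restrict-isJoin x zero)
    (trans (sym (lower-J-zero x)) (cong lower (trans (J.comm zero (suc x)) x≤0)))

  -- The elements strictly below `zero` include the least element and are closed under joins.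
  largest-below-zero : ∃ λ d → suc d ≤[ J ] zero × (∀ {x} → suc x ≤[ J ] zero → x ≤[ J⁻ ] d)
  largest-below-zero = IsJoin.greatest restrict-isJoin (λ x → J (suc x) zero Fin.≟ zero)
    (J.identityˡ zero)
    (λ {x} {y} x≤0 y≤0 → trans (cong (λ w → J w zero) (suc-restrict x y)) (J.∨-least x≤0 y≤0))

  restrict-extend : ∀ {d} → suc d ≤[ J ] zero → (∀ {x} → suc x ≤[ J ] zero → x ≤[ J⁻ ] d) →
                    extend J⁻ d ≗₂ J
  restrict-extend {d} d≤0 max-d = eq
    where
    eq₀ : ∀ x → extend J⁻ d zero (suc x) ≡ J zero (suc x)
    eq₀ x with J zero (suc x) in eq | lower-J-zero x
    ... | zero  | _    = extend-≤ J⁻ (max-d (trans (J.comm (suc x) zero) eq))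
    ... | suc w | w≡Jx = trans
      (extend-≰ J⁻ λ x≤d → Fin.0≢1+n
        (trans (sym (J.≤-trans (≤-restrict x≤d) d≤0)) (trans (J.comm (suc x) zero) eq)))
      (cong suc (sym w≡Jx))
    eq : extend J⁻ d ≗₂ J
    eq zero    zero    = sym (J.idem zero)
    eq zero    (suc y) = eq₀ y
    eq (suc x) zero    = trans (eq₀ x) (J.comm zero (suc x))
    eq (suc x) (suc y) = suc-restrict x y

extend-cong : {J K : Op₂ (Fin (suc n))} → J ≗₂ K → ∀ d → extend J d ≗₂ extend K d
extend-cong J≗K d zero    zero    = refl
extend-cong J≗K d zero    (suc y) rewrite J≗K y d | J≗K zero y = refl
extend-cong J≗K d (suc x) zero    rewrite J≗K x d | J≗K zero x = refl
extend-cong J≗K d (suc x) (suc y) = cong suc (J≗K x y)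

DownSet-bottom : ∀ {A : Set} {J : Op₂ A} {v : Vec A 1} → DownSet J v →
                 ∀ {z} → z ≤[ J ] head v → z ≡ head v
DownSet-bottom (bottom min) = min

DownSet-cover : ∀ {A : Set} {J : Op₂ A} {v : Vec A (suc (suc h))} → DownSet J v →
                ∀ {z} → z ≤[ J ] head v → z ≡ head v ⊎ z ≤[ J ] head (tail v)
DownSet-cover (cover _ _ below _) = below

-- The chain is the whole down-set of its head, so `x` is one of its entries; drops leave the join
-- alone and bring `x` to the front.
drop-to : ∀ h (p : Path n h) {x} → x ≤[ ⟦ p ⟧ ] head (chain p) →
          ∃ λ k → Σ (Path n k) λ q → ⟦ q ⟧ ≡ ⟦ p ⟧ × head (chain q) ≡ x
drop-to zero    p x≤ = zero , p , refl , sym (DownSet-bottom (chain-DownSet p) x≤)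
drop-to (suc h) p x≤ with DownSet-cover (chain-DownSet p) x≤
... | inj₁ x≡ = suc h , p , refl , sym x≡
... | inj₂ x≤ = drop-to h (drop p) x≤

-- The head is prescribed because a push takes its `d` from there. The path for the restricted join
-- gets the largest element below `zero` as its head; after the push, drops lead to the head
-- required.
⟦⟧-surjective′ : {J : Op₂ (Fin (suc n))} → IsJoin J → ∀ {d} → d ≤[ J ] zero →
                 ∃ λ h → Σ (Path n h) λ p → ⟦ p ⟧ ≗₂ J × head (chain p) ≡ d
⟦⟧-surjective′ {zero}  {J} J-isJoin {zero} _ =
  0 , [] , (λ { zero zero → sym (IsJoin.idem J-isJoin zero) }) , refl
⟦⟧-surjective′ {suc n} {J} J-isJoin {x} x≤0
  with d , d≤0 , max-d ← largest-below-zero J-isJoin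
  with h , p , p≗J⁻ , refl ← ⟦⟧-surjective′ (restrict-isJoin J-isJoin) (restrict-≤0 J-isJoin d≤0)
  = lift-path (drop-to _ (push p) {x} (trans (push≗J x zero) x≤0))
  where
  push≗J : ⟦ push p ⟧ ≗₂ J
  push≗J y z = trans (extend-cong p≗J⁻ (head (chain p)) y z) (restrict-extend J-isJoin d≤0 max-d y z)
  lift-path : (∃ λ k → Σ (Path (suc n) k) λ q → ⟦ q ⟧ ≡ ⟦ push p ⟧ × head (chain q) ≡ x) →
              ∃ λ k → Σ (Path (suc n) k) λ q → ⟦ q ⟧ ≗₂ J × head (chain q) ≡ x
  lift-path (k , q , q≡p , q₀≡x) = k , q , subst (_≗₂ J) (sym q≡p) push≗J , q₀≡x

-- Prescribing the least element as head leaves a chain with one entry, which means height zero.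
⟦⟧-surjective : {J : Op₂ (Fin (suc n))} → IsJoin J → Σ (Path n 0) λ p → ⟦ p ⟧ ≗₂ J
⟦⟧-surjective {n} {J} J-isJoin = stop (⟦⟧-surjective′ J-isJoin (IsJoin.identityˡ J-isJoin zero))
  where
  stop : (∃ λ h → Σ (Path n h) λ p → ⟦ p ⟧ ≗₂ J × head (chain p) ≡ fromℕ n) →
         Σ (Path n 0) λ p → ⟦ p ⟧ ≗₂ J
  stop (zero  , p , p≗J , _) = p , p≗J
  stop (suc h , p , _ , p₀≡⊥) = ⊥-elim (not-least (chain-DownSet p) p₀≡⊥)
    where
    not-least : ∀ {k} {v : Vec (Fin (suc n)) (suc (suc k))} → DownSet ⟦ p ⟧ v → head v ≢ fromℕ n
    not-least (cover {y = y} y≤x x≢y _ _) refl =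
      x≢y (IsJoin.≤-antisym (⟦⟧-isJoin p) (IsJoin.identityˡ (⟦⟧-isJoin p) y) y≤x)

-- Residuated lattices

max-isCommutativeMonoid : IsCommutativeMonoid {A = Fin (suc n)} _≡_ max zero
max-isCommutativeMonoid = record
  { isMonoid = record
    { isSemigroup = record
      { isMagma = record { isEquivalence = ≡.isEquivalence ; ∙-cong = cong₂ max }
      ; assoc   = max-assoc
      }
    ; identity = (λ _ → refl) , max-identityʳ
    }
  ; comm = max-comm
  }

module FinCRL {J : Op₂ (Fin (suc n))} (J-isJoin : IsJoin J) where
  private module J = IsJoin J-isJoin

  private
    meet : ∀ x y → ∃ λ m → (m ≤[ J ] x × m ≤[ J ] y) × (∀ {z} → z ≤[ J ] x × z ≤[ J ] y → z ≤[ J ] m)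
    meet x y = J.greatest (λ z → (J z x Fin.≟ x) ×-dec (J z y Fin.≟ y))
      (J.identityˡ x , J.identityˡ y)
      (λ (p , q) (p′ , q′) → J.∨-least p p′ , J.∨-least q q′)

    -- The least element is a candidate because it is the zero of `max`, and `distribˡ` closes the
    -- candidates under joins.
    residual : ∀ x z → ∃ λ m → max x m ≤[ J ] z × (∀ {y} → max x y ≤[ J ] z → y ≤[ J ] m)
    residual x z = J.greatest (λ y → J (max x y) z Fin.≟ z)
      (trans (cong (λ w → J w z) (max-zeroʳ x)) (J.identityˡ z))
      (λ {y} {y′} p q → trans (cong (λ w → J w z) (J.distribˡ x y y′)) (J.∨-least p q))

  _∧_ _⇒_ : Op₂ (Fin (suc n))
  x ∧ y = proj₁ (meet x y)
  x ⇒ z = proj₁ (residual x z)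

  orderLattice : Order.Lattice 0ℓ 0ℓ 0ℓ
  orderLattice = record
    { _≤_ = _≤[ J ]_
    ; _∨_ = J
    ; _∧_ = _∧_
    ; isLattice = record
      { isPartialOrder = record
        { isPreorder = record
          { isEquivalence = ≡.isEquivalence
          ; reflexive     = λ { refl → J.idem _ }
          ; trans         = J.≤-trans
          }
        ; antisym = J.≤-antisym
        }
      ; supremum = λ x y → J.x≤x∨y x y , J.y≤x∨y x y , λ z → J.∨-least
      ; infimum  = λ x y → let m , (m≤x , m≤y) , greatest = meet x y in
                           m≤x , m≤y , λ z z≤x z≤y → greatest (z≤x , z≤y)
      }
    }

  isLattice : IsLattice _≡_ J _∧_
  isLattice = OrderLatticeProperties.isAlgLattice orderLattice

  ≤⇒≡∧ : ∀ {x y} → x ≤[ J ] y → x ≡ x ∧ y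
  ≤⇒≡∧ {x} {y} x≤y = let m , (m≤x , _) , greatest = meet x y in
    J.≤-antisym (greatest (J.idem x , x≤y)) m≤x

  ≡∧⇒≤ : ∀ {x y} → x ≡ x ∧ y → x ≤[ J ] y
  ≡∧⇒≤ {x} {y} x≡x∧y = subst (_≤[ J ] y) (sym x≡x∧y) (proj₂ (proj₁ (proj₂ (meet x y))))

  max-monoʳ : ∀ x {y z} → y ≤[ J ] z → max x y ≤[ J ] max x z
  max-monoʳ x {y} {z} y≤z = trans (sym (J.distribˡ x y z)) (cong (max x) y≤z)

  residuatedˡ : ∀ {x y z} → max x y ≤[ J ] z → y ≤[ J ] x ⇒ z
  residuatedˡ {x} {y} {z} = proj₂ (proj₂ (residual x z))

  residuatedʳ : ∀ {x y z} → y ≤[ J ] x ⇒ z → max x y ≤[ J ] z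
  residuatedʳ {x} {y} {z} y≤ = J.≤-trans (max-monoʳ x y≤) (proj₁ (proj₂ (residual x z)))

module _ (c ℓ : Level) {J : Op₂ (Fin (suc n))} (J-isJoin : IsJoin J) where
  open FinCRL J-isJoin

  private
    A : Set c
    A = Lift c (Fin (suc n))

    lift₂ : Op₂ (Fin (suc n)) → Op₂ A
    lift₂ _∙_ x y = lift (unlift x ∙ unlift y)

    _≈_ : A → A → Set ℓ
    x ≈ y = Lift ℓ (unlift x ≡ unlift y)

    rawLattice₁ : RawLattice c ℓ
    rawLattice₁ = record { _≈_ = _≈_ ; _∨_ = lift₂ J ; _∧_ = lift₂ _∧_ }

    rawLattice₂ : RawLattice 0ℓ 0ℓ
    rawLattice₂ = record { _≈_ = _≡_ ; _∨_ = J ; _∧_ = _∧_ }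

    rawMonoid₁ : RawMonoid c ℓ
    rawMonoid₁ = record { _≈_ = _≈_ ; _∙_ = lift₂ max ; ε = lift zero }

    rawMonoid₂ : RawMonoid 0ℓ 0ℓ
    rawMonoid₂ = record { _≈_ = _≡_ ; _∙_ = max {suc n} ; ε = zero }

  -- Lifting reaches arbitrary levels `c` and `ℓ`; the laws are pulled back along the injective
  -- `unlift`.
  liftCRL : CommutativeResiduatedLattice c ℓ
  liftCRL = record
    { Carrier   = A
    ; _≈_       = _≈_
    ; _∧_       = lift₂ _∧_
    ; _∨_       = lift₂ J
    ; _·_       = lift₂ max
    ; _⇒_       = lift₂ _⇒_
    ; e         = lift zero
    ; isLattice = LatticeMonomorphism.isLattice {L₁ = rawLattice₁} {L₂ = rawLattice₂} {⟦_⟧ = unlift}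
        (record
          { isLatticeHomomorphism = record
            { isRelHomomorphism = record { cong = unlift }
            ; ∧-homo = λ _ _ → refl
            ; ∨-homo = λ _ _ → refl
            }
          ; injective = lift
          }) isLattice
    ; isCommutativeMonoid = MonoidMonomorphism.isCommutativeMonoid {M₁ = rawMonoid₁} {M₂ = rawMonoid₂} {⟦_⟧ = unlift}
        (record
          { isMonoidHomomorphism = record
            { isMagmaHomomorphism = record
              { isRelHomomorphism = record { cong = unlift }
              ; homo = λ _ _ → refl
              }
            ; ε-homo = refl
            }
          ; injective = lift
          }) max-isCommutativeMonoid
    ; ⇒-cong     = λ (lift p) (lift q) → lift (cong₂ _⇒_ p q)
    ; residuated = λ _ _ _ → mk⇔
        (λ (lift p) → lift (≤⇒≡∧ (residuatedˡ (≡∧⇒≤ p))))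
        (λ (lift p) → lift (≤⇒≡∧ (residuatedʳ (≡∧⇒≤ p))))
    }

  finiteCRL : FiniteConservativeCRL c ℓ (suc n)
  finiteCRL = record
    { crl            = liftCRL
    ; conservative   = λ (lift x) (lift y) → [ inj₁ ∘ lift , inj₂ ∘ lift ]′ (max-sel x y)
    ; hasCardinality = record
      { to        = lift
      ; cong      = lift
      ; bijective = unlift , λ (lift x) → x , lift
      }
    }

-- Order, product and isomorphisms in arbitrary algebras

module CRLProperties (L : CommutativeResiduatedLattice c ℓ) where
  open CommutativeResiduatedLattice L public renaming (_≤_ to _≼_)
  open IsCommutativeMonoid isCommutativeMonoid public
    using () renaming (assoc to ·-assoc; comm to ·-comm; identityˡ to ·-identityˡ; identityʳ to ·-identityʳ)
  open LatticeProperties lattice using (∨-∧-orderTheoreticLattice)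
  open Lattice lattice public
    using (∨-assoc; ∨-comm; ∨-cong)
  open LatticeProperties lattice public using (∨-idem)
  open Order.Lattice ∨-∧-orderTheoreticLattice public
    using (x≤x∨y; y≤x∨y; ∨-least; x∧y≤x; x∧y≤y; ∧-greatest; joinSemilattice)
  open Poset poset public using (antisym)
    renaming (refl to ≤-refl; trans to ≤-trans; ≤-respˡ-≈ to ≤-respˡ; ≤-respʳ-≈ to ≤-respʳ)
  open JoinProperties joinSemilattice public using (x≤y⇒x∨y≈y)
  module ≈ = Setoid setoid

  x∨y≈y⇒x≤y : ∀ {x y} → x ∨ y ≈ y → x ≼ y
  x∨y≈y⇒x≤y x∨y≈y = ≤-respʳ x∨y≈y (x≤x∨y _ _)

  residuate : ∀ {x y z} → x · y ≼ z → y ≼ (x ⇒ z)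
  residuate = Equivalence.to (residuated _ _ _)

  unresiduate : ∀ {x y z} → y ≼ (x ⇒ z) → x · y ≼ z
  unresiduate = Equivalence.from (residuated _ _ _)

  ·-monoʳ : ∀ x {y z} → y ≼ z → x · y ≼ x · z
  ·-monoʳ x y≤z = unresiduate (≤-trans y≤z (residuate ≤-refl))

  -- Multiplication by `x` is a left adjoint, so it preserves joins.
  ·-distribˡ-∨ : ∀ x y z → x · (y ∨ z) ≈ (x · y) ∨ (x · z)
  ·-distribˡ-∨ x y z = antisym
    (unresiduate (∨-least (residuate (x≤x∨y _ _)) (residuate (y≤x∨y _ _))))
    (∨-least (·-monoʳ x (x≤x∨y y z)) (·-monoʳ x (y≤x∨y y z)))

  -- o ≼ x because o · (o ⇒ x) ≼ x.
  zero-least : ∀ {o} → (∀ y → o · y ≈ o) → ∀ x → o ≼ x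
  zero-least {o} o-zero x = ≤-respˡ (o-zero (o ⇒ x)) (unresiduate ≤-refl)

module _ {L M : CommutativeResiduatedLattice c ℓ} where
  private
    module L = CRLProperties L
    module M = CRLProperties M

  -- Meets and residuals are characterised by the order and the product, and the unit by the
  -- product. A bijection preserving joins also reflects the order, so all the operations are
  -- carried over.
  ∨-·-isIsomorphism : (f : L.Carrier → M.Carrier) → Congruent L._≈_ M._≈_ f →
    Injective L._≈_ M._≈_ f → (∀ y → ∃ λ x → f x M.≈ y) →
    (∀ x y → f (x L.∨ y) M.≈ f x M.∨ f y) →
    (∀ x y → f (x L.· y) M.≈ f x M.· f y) →
    IsIsomorphism L M f
  ∨-·-isIsomorphism f f-cong f-inj f-surj ∨-homo ·-homo = record
    { isLatticeIsomorphism = record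
      { isLatticeMonomorphism = record
        { isLatticeHomomorphism = record
          { isRelHomomorphism = record { cong = f-cong }
          ; ∧-homo = ∧-homo
          ; ∨-homo = ∨-homo
          }
        ; injective = f-inj
        }
      ; surjective = λ y → let x , fx≈y = f-surj y in x , λ z≈x → M.≈.trans (f-cong z≈x) fx≈y
      }
    ; ·-homo = ·-homo
    ; ⇒-homo = ⇒-homo
    ; e-homo = e-homo
    }
    where
    mono : ∀ {x y} → x L.≼ y → f x M.≼ f y
    mono {x} {y} x≤y = M.x∨y≈y⇒x≤y
      (M.≈.trans (M.≈.sym (∨-homo x y)) (f-cong (L.x≤y⇒x∨y≈y x≤y)))

    reflects : ∀ {x y} → f x M.≼ f y → x L.≼ y
    reflects {x} {y} fx≤fy = L.x∨y≈y⇒x≤y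
      (f-inj (M.≈.trans (∨-homo x y) (M.x≤y⇒x∨y≈y fx≤fy)))

    ∧-homo : ∀ x y → f (x L.∧ y) M.≈ f x M.∧ f y
    ∧-homo x y with w , fw≈ ← f-surj (f x M.∧ f y) = M.antisym
      (M.∧-greatest (mono (L.x∧y≤x x y)) (mono (L.x∧y≤y x y)))
      (M.≤-respˡ fw≈ (mono (L.∧-greatest
        (reflects (M.≤-respˡ (M.≈.sym fw≈) (M.x∧y≤x _ _)))
        (reflects (M.≤-respˡ (M.≈.sym fw≈) (M.x∧y≤y _ _))))))

    ⇒-homo : ∀ x y → f (x L.⇒ y) M.≈ (f x M.⇒ f y)
    ⇒-homo x y with w , fw≈ ← f-surj (f x M.⇒ f y) = M.antisym
      (M.residuate (M.≤-respˡ (·-homo x (x L.⇒ y)) (mono (L.unresiduate L.≤-refl))))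
      (M.≤-respˡ fw≈ (mono (L.residuate (reflects
        (M.≤-respˡ (M.≈.sym (·-homo x w))
          (M.unresiduate (M.≤-respˡ (M.≈.sym fw≈) M.≤-refl)))))))

    e-homo : f L.e M.≈ M.e
    e-homo with w , fw≈e ← f-surj M.e = begin
      f L.e              ≈⟨ M.·-identityʳ (f L.e) ⟨
      f L.e M.· M.e      ≈⟨ M.·-cong M.≈.refl fw≈e ⟨
      f L.e M.· f w      ≈⟨ ·-homo L.e w ⟨
      f (L.e L.· w)      ≈⟨ f-cong (L.·-identityˡ w) ⟩
      f w                ≈⟨ fw≈e ⟩
      M.e                ∎
      where open ≈-Reasoning M.setoid

-- The product of a conservative algebra is the meet of a linear order, so
-- sorting the elements in descending order turns it into max on indices.
module _ (A : FiniteConservativeCRL c ℓ n) where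
  open FiniteConservativeCRL A
  open CRLProperties crl

  -- The length is a parameter because that of the sorted list equals `n` only propositionally.
  Sorting : ℕ → Set _
  Sorting m = Σ (Fin m → Carrier) λ f →
    Injective _≡_ _≈_ f × (∀ x → ∃ λ i → f i ≈ x) × (∀ i j → f i · f j ≈ f (max i j))

  private
    module B = Bijection hasCardinality

    _≈?_ : Binary.Decidable _≈_
    x ≈? y = map′
      (λ eq → ≈.trans (≈.sym (proj₂ (B.strictlySurjective x)))
                (≈.trans (B.cong eq) (proj₂ (B.strictlySurjective y))))
      (λ x≈y → B.injective (≈.trans (proj₂ (B.strictlySurjective x))
                (≈.trans x≈y (≈.sym (proj₂ (B.strictlySurjective y))))))
      (B.to⁻ x Fin.≟ B.to⁻ y)

    ·-idem : Idempotent _≈_ _·_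
    ·-idem x = [ id , id ]′ (conservative x x)

    ·-isSemilattice : IsSemilattice _≈_ _·_
    ·-isSemilattice = record
      { isBand = record
        { isSemigroup = IsCommutativeMonoid.isSemigroup isCommutativeMonoid
        ; idem        = ·-idem
        }
      ; comm = ·-comm
      }

    -- Conservativity makes the natural order of the product total; flipping it lets the unit come
    -- first.
    ⊒-decTotalOrder : DecTotalOrder _ _ _
    ⊒-decTotalOrder = Flip.decTotalOrder
      (NaturalOrder.decTotalOrder _≈_ _·_ ·-isSemilattice conservative _≈?_)

    open DecTotalOrder ⊒-decTotalOrder using () renaming (_≤_ to _⊒_; trans to ⊒-trans)
    open Sort ⊒-decTotalOrder using (sort; sort-↗; sortingAlgorithm)

    lookup-max : ∀ {xs} → AllPairs _⊒_ xs → ∀ i j → lookup xs i · lookup xs j ≈ lookup xs (max i j)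
    lookup-max {x ∷ _} (x⊒ ∷ _)  zero    zero    = ·-idem x
    lookup-max         (x⊒ ∷ _)  zero    (suc j) = ≈.sym (All.lookup x⊒ (∈-lookup j))
    lookup-max         (x⊒ ∷ _)  (suc i) zero    = ≈.trans (·-comm _ _) (≈.sym (All.lookup x⊒ (∈-lookup i)))
    lookup-max         (_ ∷ xs⊒) (suc i) (suc j) = lookup-max xs⊒ i j

    elements : List Carrier
    elements = tabulate B.to

    sorted↭elements = SortBase.SortingAlgorithm.sort-↭ₛ sortingAlgorithm elements

    module π = Inverse (Permutation.onIndices sorted↭elements)

    length-elements : length elements ≡ n
    length-elements = length-tabulate B.to

    lookup-elements : ∀ i → lookup elements i ≡ B.to (cast length-elements i)
    lookup-elements i = trans
      (cong (lookup elements) (sym (Fin.cast-involutive (sym length-elements) length-elements i)))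
      (lookup-tabulate B.to (cast length-elements i))

    cast-π : Fin (length (sort elements)) → Fin n
    cast-π i = cast length-elements (π.to i)

    -- The sorted list is the given enumeration after a bijection of indices, from which it inherits
    -- bijectivity.
    lookup-sorted : ∀ i → lookup (sort elements) i ≈ B.to (cast-π i)
    lookup-sorted i = ≈.trans
      (PermutationProperties.onIndices-lookup setoid sorted↭elements i)
      (≈.reflexive (lookup-elements (π.to i)))

    cast-π-injective : ∀ {i j} → cast-π i ≡ cast-π j → i ≡ j
    cast-π-injective {i} {j} eq = trans (sym (π.inverseʳ refl)) (trans (cong π.from πi≡πj) (π.inverseʳ refl))
      where
      πi≡πj : π.to i ≡ π.to j
      πi≡πj = trans (sym (Fin.cast-involutive (sym length-elements) length-elements (π.to i)))
        (trans (cong (cast (sym length-elements)) eq)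
          (Fin.cast-involutive (sym length-elements) length-elements (π.to j)))

    sorting′ : Sorting (length (sort elements))
    sorting′ = lookup (sort elements) ,
      (λ {i} {j} eq → cast-π-injective (B.injective
        (≈.trans (≈.sym (lookup-sorted i)) (≈.trans eq (lookup-sorted j))))) ,
      (λ x → let k , k≈x = B.strictlySurjective x
                 i = π.from (cast (sym length-elements) k)
                 eq = trans (cong (cast length-elements) (π.inverseˡ refl))
                        (Fin.cast-involutive length-elements (sym length-elements) k)
             in i , ≈.trans (lookup-sorted i) (≈.trans (B.cong eq) k≈x)) ,
      lookup-max (Linked⇒AllPairs ⊒-trans (sort-↗ elements))

  sorting : Sorting n
  sorting = subst Sorting
    (trans (PermutationProperties.xs↭ys⇒|xs|≡|ys| setoid sorted↭elements) length-elements)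
    sorting′

-- Rigidity of the chain and classification

≢zero⇒suc : {x : Fin (suc n)} → x ≢ zero → ∃ λ y → x ≡ suc y
≢zero⇒suc {x = zero}  x≢0 = ⊥-elim (x≢0 refl)
≢zero⇒suc {x = suc y} _   = y , refl

-- The unit `zero` must be fixed; removing it leaves a map `τ` of the same kind on a shorter chain.
max-rigid : (σ : Fin n → Fin n) → Injective _≡_ _≡_ σ → (∀ y → ∃ λ x → σ x ≡ y) →
            (∀ x y → σ (max x y) ≡ max (σ x) (σ y)) → ∀ x → σ x ≡ x
max-rigid {suc n} σ inj surj homo = fixes
  where
  open ≡-Reasoning

  σ0≡0 : σ zero ≡ zero
  σ0≡0 with j , σj≡0 ← surj zero = begin
    σ zero                ≡⟨ max-identityʳ (σ zero) ⟨
    max (σ zero) zero     ≡⟨ cong (max (σ zero)) σj≡0 ⟨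
    max (σ zero) (σ j)    ≡⟨ homo zero j ⟨
    σ j                   ≡⟨ σj≡0 ⟩
    zero                  ∎

  σ-suc : ∀ x → ∃ λ y → σ (suc x) ≡ suc y
  σ-suc x = ≢zero⇒suc λ σx≡0 → Fin.0≢1+n (inj (trans σ0≡0 (sym σx≡0)))

  τ : Fin n → Fin n
  τ x = proj₁ (σ-suc x)

  σ-suc≡ : ∀ x → σ (suc x) ≡ suc (τ x)
  σ-suc≡ x = proj₂ (σ-suc x)

  τ-surj : ∀ y → ∃ λ x → τ x ≡ y
  τ-surj y with surj (suc y)
  ... | zero  , σ0≡ = ⊥-elim (Fin.0≢1+n (trans (sym σ0≡0) σ0≡))
  ... | suc x , σx≡ = x , Fin.suc-injective (trans (sym (σ-suc≡ x)) σx≡)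

  τ-fixes : ∀ x → τ x ≡ x
  τ-fixes = max-rigid τ
    (λ {x} {y} eq → Fin.suc-injective (inj (trans (σ-suc≡ x) (trans (cong suc eq) (sym (σ-suc≡ y))))))
    τ-surj
    (λ x y → Fin.suc-injective (trans (sym (σ-suc≡ (max x y)))
      (trans (homo (suc x) (suc y)) (cong₂ max (σ-suc≡ x) (σ-suc≡ y)))))

  fixes : ∀ x → σ x ≡ x
  fixes zero    = σ0≡0
  fixes (suc x) = trans (σ-suc≡ x) (cong suc (τ-fixes x))

-- Both products are `max`, so by rigidity any isomorphism is the identity on indices.
liftCRL-injective : {J K : Op₂ (Fin (suc n))} (J-isJoin : IsJoin J) (K-isJoin : IsJoin K) →
                    liftCRL c ℓ J-isJoin ≅ liftCRL c ℓ K-isJoin → J ≗₂ K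
liftCRL-injective {J = J} {K} J-isJoin K-isJoin (f , f-iso) x y = begin
  J x y          ≡⟨ σ-fixes (J x y) ⟨
  σ (J x y)      ≡⟨ unlift (F.∨-homo (lift x) (lift y)) ⟩
  K (σ x) (σ y)  ≡⟨ cong₂ K (σ-fixes x) (σ-fixes y) ⟩
  K x y          ∎
  where
  open ≡-Reasoning
  module F = IsIsomorphism f-iso
  σ : Fin _ → Fin _
  σ i = unlift (f (lift i))
  σ-fixes : ∀ i → σ i ≡ i
  σ-fixes = max-rigid σ
    (λ eq → unlift (F.injective (lift eq)))
    (λ j → let x , fz≈ = F.surjective (lift j) in unlift x , unlift (fz≈ (lift refl)))
    (λ i j → unlift (F.·-homo (lift i) (lift j)))

-- Sorting transports the join to indices. The conclusion admits every `K` pointwise equal to `J`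
-- because a decoded path agrees with `J` only pointwise.
liftCRL-surjective : (A : FiniteConservativeCRL c ℓ (suc n)) →
  ∃ λ J → Σ (IsJoin J) λ J-isJoin → ∀ {K} (K-isJoin : IsJoin K) → K ≗₂ J →
  liftCRL c ℓ K-isJoin ≅ FiniteConservativeCRL.crl A
liftCRL-surjective {n = n} A with f , f-inj , f-surj , f-max ← sorting A =
  J , J-isJoin , λ K-isJoin K≗J →
  f ∘ unlift , ∨-·-isIsomorphism (f ∘ unlift)
    (λ (lift eq) → f-cong eq) (λ eq → lift (f-inj eq))
    (λ y → let i , fi≈y = f-surj y in lift i , fi≈y)
    (λ (lift i) (lift j) → ≈.trans (f-cong (K≗J i j)) (f-J i j))
    (λ (lift i) (lift j) → ≈.sym (f-max i j))
  where
  open FiniteConservativeCRL A using (crl)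
  open CRLProperties crl
  open ≈-Reasoning setoid

  f-cong : ∀ {i j} → i ≡ j → f i ≈ f j
  f-cong refl = ≈.refl

  J : Op₂ (Fin (suc n))
  J i j = proj₁ (f-surj (f i ∨ f j))

  f-J : ∀ i j → f (J i j) ≈ f i ∨ f j
  f-J i j = proj₂ (f-surj (f i ∨ f j))

  f-bottom : ∀ x → f (fromℕ n) ≼ x
  f-bottom = zero-least λ y → let i , fi≈y = f-surj y in begin
    f (fromℕ n) · y          ≈⟨ ·-cong ≈.refl fi≈y ⟨
    f (fromℕ n) · f i        ≈⟨ ·-comm (f (fromℕ n)) (f i) ⟩
    f i · f (fromℕ n)        ≈⟨ f-max i (fromℕ n) ⟩
    f (max i (fromℕ n))      ≈⟨ f-cong (max-zeroʳ i) ⟩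
    f (fromℕ n)              ∎

  J-isJoin : IsJoin J
  J-isJoin = record
    { assoc     = λ i j k → f-inj (begin
        f (J (J i j) k)        ≈⟨ f-J (J i j) k ⟩
        f (J i j) ∨ f k        ≈⟨ ∨-cong (f-J i j) ≈.refl ⟩
        (f i ∨ f j) ∨ f k      ≈⟨ ∨-assoc (f i) (f j) (f k) ⟩
        f i ∨ (f j ∨ f k)      ≈⟨ ∨-cong ≈.refl (f-J j k) ⟨
        f i ∨ f (J j k)        ≈⟨ f-J i (J j k) ⟨
        f (J i (J j k))        ∎)
    ; comm      = λ i j → f-inj (begin
        f (J i j)              ≈⟨ f-J i j ⟩
        f i ∨ f j              ≈⟨ ∨-comm (f i) (f j) ⟩
        f j ∨ f i              ≈⟨ f-J j i ⟨
        f (J j i)              ∎)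
    ; idem      = λ i → f-inj (≈.trans (f-J i i) (∨-idem (f i)))
    ; identityˡ = λ i → f-inj (≈.trans (f-J (fromℕ n) i) (x≤y⇒x∨y≈y (f-bottom (f i))))
    ; distribˡ  = λ k i j → f-inj (begin
        f (max k (J i j))              ≈⟨ f-max k (J i j) ⟨
        f k · f (J i j)                ≈⟨ ·-cong ≈.refl (f-J i j) ⟩
        f k · (f i ∨ f j)              ≈⟨ ·-distribˡ-∨ (f k) (f i) (f j) ⟩
        (f k · f i) ∨ (f k · f j)      ≈⟨ ∨-cong (f-max k i) (f-max k j) ⟩
        f (max k i) ∨ f (max k j)      ≈⟨ f-J (max k i) (max k j) ⟨
        f (J (max k i) (max k j))      ∎)
    }

-- Counting the algebras

path-bijection : ∀ c ℓ n → Bijection (≡.setoid (Path n 0)) (finiteConservativeCRLs c ℓ (suc n))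
path-bijection c ℓ n = record
  { to        = λ p → finiteCRL c ℓ (⟦⟧-isJoin p)
  ; cong      = λ { refl → ≅-refl }
  ; bijective =
      (λ {p} {q} p≅q → ⟦⟧-injective p q
        (liftCRL-injective (⟦⟧-isJoin p) (⟦⟧-isJoin q) p≅q)) ,
      (λ A → let J , J-isJoin , iso = liftCRL-surjective A
                 p , p≗J = ⟦⟧-surjective J-isJoin
             in p , λ { refl → iso (⟦⟧-isJoin p) p≗J })
  }

theorem5p6 : (c ℓ : Level) (n : ℕ) → 1 ≤ n →
    HasCardinality (finiteConservativeCRLs c ℓ n) (catalan (n ∸ 1))
    × n * catalan (n ∸ 1) ≡ (2 * (n ∸ 1)) C (n ∸ 1)
theorem5p6 c ℓ (suc k) (s≤s _) =
  -- Algebras with `suc k` elements match paths with `k` pushes, since the empty path already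
  -- encodes the one-element algebra.
  subst (HasCardinality (finiteConservativeCRLs c ℓ (suc k))) (ballot≡catalan k)
    (bijection (Inverse⇒Bijection (enumerate k 0 refl)) (path-bijection c ℓ k)) ,
  subst (λ m → suc k * m ≡ (2 * k) C k) (ballot≡catalan k) ([k+1]*ballot k)
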